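{- For all integers $n\ge 0$, $$F(n;n,0)=1,$$ $$F(n+2;n,0)=\tfrac12(n+1)(n+4),$$ $$F(n+4;n,0)=\tfrac1{12}(n+1)(n^3+15n^2+74n+132),$$ $$F(n+6;n,0)=\tfrac1{144}(n+1)(n^5+32n^4+407n^3+2620n^2+8604n+12240).$$ More generally, for every integer $k\ge 0$ there is a polynomial $s_k(n)$ in $n$, of degree $2k$ with leading coefficient $\frac{1}{k!\,(k+1)!}$, such that $$F(n+2k;n,0)=s_k(n)\quad\text{for all integers } n\ge 0,$$ and $s_k(n)$ is divisible by $n+1$ for $k\ge 1$.
   Context: For integers $m\ge 0$ and $n_1,n_2$, $F(m;n_1,n_2)$ denotes the number of Gessel walks with exactly $m$ steps from $(0,0)$ to $(n_1,n_2)$: lattice walks starting at the origin, each of whose $m$ steps is one of West $(-1,0)$, North-East $(1,1)$, East $(1,0)$, South-West $(-1,-1)$, and which remain in the first quadrant $\{(i,j): i\ge 0, j\ge 0\}$. In particular $F(m;n_1,n_2)=0$ if $n_1<0$ or $n_2<0$, and $F(0;n_1,n_2)=1$ if $n_1=n_2=0$ and $0$ otherwise. Polynomials have rational coefficients and divisibility is in $\mathbb{Q}[n]$. -}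

module Defs where

open import Algebra.Bundles.Raw using (RawMagma)
import Algebra.Definitions.RawMagma as Divisibility
open import Data.Integer as ℤ using (ℤ; +_; 0ℤ; 1ℤ; -1ℤ)
import Data.Integer.Properties as ℤ
open import Data.List using (List; []; _∷_; cartesianProductWith; filter; foldl; length; map)
open import Data.List.Relation.Unary.All using (All; all?)
open import Data.List.Scans.Base using (scanl)
open import Data.Nat as ℕ using (ℕ; zero; suc)
open import Data.Product using (_×_; _,_)
open import Data.Product.Properties using (≡-dec)
open import Data.Rational as ℚ using (ℚ; 0ℚ; 1ℚ)
open import Level using (0ℓ)
open import Relation.Binary.PropositionalEquality using (_≡_; _≢_)
open import Relation.Unary using (Decidable)
open import Relation.Nullary.Decidable using (_×-dec_)

data Step : Set where
  west north-east east south-west : Step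

steps : List Step
steps = west ∷ north-east ∷ east ∷ south-west ∷ []

Point : Set
Point = ℤ × ℤ

origin : Point
origin = 0ℤ , 0ℤ

displacement : Step → Point
displacement west       = -1ℤ , 0ℤ
displacement north-east =  1ℤ , 1ℤ
displacement east       =  1ℤ , 0ℤ
displacement south-west = -1ℤ , -1ℤ

move : Point → Step → Point
move (i , j) s = let (di , dj) = displacement s in i ℤ.+ di , j ℤ.+ dj

InQuadrant : Point → Set
InQuadrant (i , j) = 0ℤ ℤ.≤ i × 0ℤ ℤ.≤ j

inQuadrant? : Decidable InQuadrant
inQuadrant? (i , j) = (0ℤ ℤ.≤? i) ×-dec (0ℤ ℤ.≤? j)

-- All points visited by a walk from the origin, both endpoints included.
visited : List Step → List Point
visited = scanl move origin

GesselWalkTo : Point → List Step → Set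
GesselWalkTo p w = All InQuadrant (visited w) × foldl move origin w ≡ p

gesselWalkTo? : ∀ p → Decidable (GesselWalkTo p)
gesselWalkTo? p w =
  all? inQuadrant? (visited w) ×-dec ≡-dec ℤ._≟_ ℤ._≟_ (foldl move origin w) p

stepSequences : ℕ → List (List Step)
stepSequences zero    = [] ∷ []
stepSequences (suc m) = cartesianProductWith _∷_ steps (stepSequences m)

F : ℕ → ℤ → ℤ → ℕ
F m n₁ n₂ = length (filter (gesselWalkTo? (n₁ , n₂)) (stepSequences m))

fromℕ : ℕ → ℚ
fromℕ n = + n ℚ./ 1

-- Coefficient lists, constant term first.  Trailing zeros are allowed, so
-- equality of polynomials is _≈_ rather than _≡_.
Polynomial : Set
Polynomial = List ℚ

coeff : Polynomial → ℕ → ℚ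
coeff []      _       = 0ℚ
coeff (a ∷ _) zero    = a
coeff (_ ∷ p) (suc i) = coeff p i

infix 4 _≈_

_≈_ : Polynomial → Polynomial → Set
p ≈ q = ∀ i → coeff p i ≡ coeff q i

infixl 6 _⊕_
infixl 7 _⊛_

_⊕_ : Polynomial → Polynomial → Polynomial
[]      ⊕ q       = q
(a ∷ p) ⊕ []      = a ∷ p
(a ∷ p) ⊕ (b ∷ q) = (a ℚ.+ b) ∷ (p ⊕ q)

_⊛_ : Polynomial → Polynomial → Polynomial
[]      ⊛ q = []
(a ∷ p) ⊛ q = map (a ℚ.*_) q ⊕ (0ℚ ∷ (p ⊛ q))

⊛-rawMagma : RawMagma 0ℓ 0ℓ
⊛-rawMagma = record { Carrier = Polynomial ; _≈_ = _≈_ ; _∙_ = _⊛_ }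

open Divisibility ⊛-rawMagma public using (_∣_)

eval : Polynomial → ℚ → ℚ
eval []      x = 0ℚ
eval (a ∷ p) x = a ℚ.+ x ℚ.* eval p x

HasDegree : Polynomial → ℕ → Set
HasDegree p d = coeff p d ≢ 0ℚ × (∀ i → d ℕ.< i → coeff p i ≡ 0ℚ)

X+1 : Polynomial
X+1 = 1ℚ ∷ 1ℚ ∷ []

{-# OPTIONS --safe #-}
-- For fixed k and j, a last-step decomposition gives, for G k j n = F(n+2k; n, j),
--   G k j (n+1) − G k j n = G k (j−1) n + G (k−1) j (n+2) + G (k−1) (j+1) (n+2),
--   G k j 0 = G (k−1) j 1 + G (k−1) (j+1) 1   for k ≥ 1.
-- Hence the Newton coefficients of G k j (its iterated differences at 0) are natural
-- numbers which obey a recursion and vanish beyond index 2k+j, so G k j is a polynomial of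
-- degree at most 2k+j.  The coefficients at index 2k+j satisfy the ballot recursion, which
-- yields the leading coefficient.  Read at n = −1, the recursion collapses to
-- G k j (−1) = −G k (j−1) (−1) for k ≥ 1, so −1 is a root and n+1 is a factor.
module Submission where

open import Defs
open import Algebra.Definitions.RawMagma ⊛-rawMagma using (_,_)
open import Data.Bool using (true; false; if_then_else_)
open import Data.Integer as ℤ using (+_; 1ℤ; -1ℤ)
import Data.Integer.Properties as ℤ
open import Data.List using (List; []; _∷_; _++_; cartesianProductWith; filter; foldl; length; map)
open import Data.List.Properties using (filter-++; filter-none; filter-≐; length-++)
open import Data.List.Relation.Unary.All as All using (All; []; _∷_; all?)
open import Data.List.Scans.Base using (scanl)
open import Data.Nat using (ℕ; zero; suc; NonZero; _+_; _*_; _^_; _≤_; _<_; s≤s; _!)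
open import Data.Nat.ListAction using (sum)
open import Data.Nat.Properties using (_!≢0; _!*_!≢0; +-comm; +-identityʳ; +-suc; *-comm; ≤-refl; ≤-reflexive; ≤-trans; <⇒≤; m<n⇒m<1+n; n<1+n; n≤1+n)
open import Data.Nat.Tactic.RingSolver using (solve-∀)
open import Data.Product using (_×_; _,_; ∃-syntax; proj₁; proj₂)
open import Data.Product.Properties using (≡-dec)
open import Data.Rational as ℚ using (ℚ; 0ℚ; 1ℚ; _/_; toℚᵘ)
import Data.Rational.Properties as ℚ
open import Data.Rational.Solver using (module +-*-Solver)
open import Data.Rational.Unnormalised as ℚᵘ using (mkℚᵘ)
import Data.Rational.Unnormalised.Properties as ℚᵘ
open import Function using (_∘_)
open import Level using (0ℓ)
open import Relation.Binary.PropositionalEquality using (_≡_; _≢_; refl; sym; trans; cong; cong₂; subst; module ≡-Reasoning)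
open import Relation.Nullary using (¬_; Dec; does; yes; no; contradiction)
open import Relation.Nullary.Decidable using (_×-dec_)
open import Relation.Unary using (Pred; Decidable)
open ≡-Reasoning
open +-*-Solver using (solve; _:+_; _:*_; :-_; _:-_; _:=_; con)

-- Counting in filtered lists and finite sums

length-filter-map : ∀ {A B : Set} {P : Pred B 0ℓ} (P? : Decidable P) (f : A → B) xs →
  length (filter P? (map f xs)) ≡ length (filter (P? ∘ f) xs)
length-filter-map P? f []       = refl
length-filter-map P? f (x ∷ xs) with does (P? (f x))
... | true  = cong suc (length-filter-map P? f xs)
... | false = length-filter-map P? f xs

length-filter-singleton : ∀ {A : Set} {P Q : Pred A 0ℓ} (P? : Decidable P) (Q? : Decidable Q) {x} →
  (P x → Q x) → (Q x → P x) →
  length (filter P? (x ∷ [])) ≡ length (filter Q? (x ∷ []))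
length-filter-singleton P? Q? {x} P⇒Q Q⇒P with P? x | Q? x
... | yes _ | yes _ = refl
... | yes p | no ¬q = contradiction (P⇒Q p) ¬q
... | no ¬p | yes q = contradiction (Q⇒P q) ¬p
... | no _  | no _  = refl

-- Grouping by the first component turns a count over `stepSequences (suc m)` into a sum over the
-- first step.
length-filter-cartesianProductWith :
  ∀ {A B C : Set} {P : Pred C 0ℓ} (P? : Decidable P) (f : A → B → C) xs ys →
  length (filter P? (cartesianProductWith f xs ys)) ≡
  sum (map (λ x → length (filter (P? ∘ f x) ys)) xs)
length-filter-cartesianProductWith P? f []       ys = refl
length-filter-cartesianProductWith P? f (x ∷ xs) ys = begin
  length (filter P? (map (f x) ys ++ rest))
    ≡⟨ cong length (filter-++ P? (map (f x) ys) rest) ⟩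
  length (filter P? (map (f x) ys) ++ filter P? rest)
    ≡⟨ length-++ (filter P? (map (f x) ys)) ⟩
  length (filter P? (map (f x) ys)) + length (filter P? rest)
    ≡⟨ cong₂ _+_ (length-filter-map P? (f x) ys)
                 (length-filter-cartesianProductWith P? f xs ys) ⟩
  length (filter (P? ∘ f x) ys) + sum (map (λ x′ → length (filter (P? ∘ f x′) ys)) xs) ∎
  where rest = cartesianProductWith f xs ys

sum-map-cong : ∀ {A : Set} {f g : A → ℕ} → (∀ x → f x ≡ g x) →
  ∀ xs → sum (map f xs) ≡ sum (map g xs)
sum-map-cong f≗g []       = refl
sum-map-cong f≗g (x ∷ xs) = cong₂ _+_ (f≗g x) (sum-map-cong f≗g xs)

sum-map-0 : ∀ {A : Set} (xs : List A) → sum (map (λ _ → 0) xs) ≡ 0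
sum-map-0 []       = refl
sum-map-0 (_ ∷ xs) = sum-map-0 xs

+-interchange : ∀ a b c d → (a + b) + (c + d) ≡ (a + c) + (b + d)
+-interchange = solve-∀

sum-map-+ : ∀ {A : Set} (f g : A → ℕ) xs →
  sum (map (λ x → f x + g x) xs) ≡ sum (map f xs) + sum (map g xs)
sum-map-+ f g []       = refl
sum-map-+ f g (x ∷ xs) = trans (cong (λ z → f x + g x + z) (sum-map-+ f g xs))
                               (+-interchange (f x) (g x) _ _)

sum-swap : ∀ {A B : Set} (f : A → B → ℕ) xs ys →
  sum (map (λ x → sum (map (f x) ys)) xs) ≡ sum (map (λ y → sum (map (λ x → f x y) xs)) ys)
sum-swap f []       ys = sym (sum-map-0 ys)
sum-swap f (x ∷ xs) ys =
  trans (cong₂ _+_ refl (sum-swap f xs ys))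
        (sym (sum-map-+ (f x) (λ y → sum (map (λ x′ → f x′ y) xs)) ys))

-- Walks between two points: removing the first or the last step

WalkBetween : Point → Point → List Step → Set
WalkBetween q p w = All InQuadrant (scanl move q w) × foldl move q w ≡ p

walkBetween? : ∀ q p → Decidable (WalkBetween q p)
walkBetween? q p w =
  all? inQuadrant? (scanl move q w) ×-dec ≡-dec ℤ._≟_ ℤ._≟_ (foldl move q w) p

-- The starting point is free because removing the first step changes it. `F m n₁ n₂` is
-- definitionally `walks m origin (n₁ , n₂)`.
walks : ℕ → Point → Point → ℕ
walks m q p = length (filter (walkBetween? q p) (stepSequences m))

-- The decision is an argument, so proofs can split on it; at coordinates of known sign the
-- conditional computes away.
onlyIf : ∀ {A : Set} → Dec A → ℕ → ℕ
onlyIf d x = if does d then x else 0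

onlyIf-sum : ∀ {A B : Set} (d : Dec A) (f : B → ℕ) xs →
  onlyIf d (sum (map f xs)) ≡ sum (map (onlyIf d ∘ f) xs)
onlyIf-sum (yes _) f xs = refl
onlyIf-sum (no _)  f xs = sym (sum-map-0 xs)

onlyIf-comm : ∀ {A B : Set} (d : Dec A) (e : Dec B) x → onlyIf d (onlyIf e x) ≡ onlyIf e (onlyIf d x)
onlyIf-comm (yes _) (yes _) x = refl
onlyIf-comm (yes _) (no _)  x = refl
onlyIf-comm (no _)  (yes _) x = refl
onlyIf-comm (no _)  (no _)  x = refl

guard : Point → ℕ → ℕ
guard p = onlyIf (inQuadrant? p)

walks-empty : ∀ m q p → (∀ w → ¬ WalkBetween q p w) → walks m q p ≡ 0
walks-empty m q p none =
  cong length (filter-none (walkBetween? q p) (All.universal none (stepSequences m)))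

-- `scanl` lists the starting point too, so nothing is counted from outside the quadrant; from
-- inside, dropping the first step loses no condition.
walks-first : ∀ m q p → walks (suc m) q p ≡ guard q (sum (map (λ s → walks m (move q s) p) steps))
walks-first m q p = split (inQuadrant? q)
  where
  split : (d : Dec (InQuadrant q)) →
    walks (suc m) q p ≡ onlyIf d (sum (map (λ s → walks m (move q s) p) steps))
  split (no q∉) = walks-empty (suc m) q p λ { [] (q∈ ∷ _ , _) → q∉ q∈ ; (_ ∷ _) (q∈ ∷ _ , _) → q∉ q∈ }
  split (yes q∈) = trans
    (length-filter-cartesianProductWith (walkBetween? q p) _∷_ steps (stepSequences m))
    (sum-map-cong
      (λ s → cong length
        (filter-≐ (walkBetween? q p ∘ (s ∷_)) (walkBetween? (move q s) p)
          ((λ { (_ ∷ inside , end) → inside , end }) , (λ { (inside , end) → q∈ ∷ inside , end }))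
          (stepSequences m)))
      steps)

-- The inverse of `move` by the same step. `ℤ.suc` puts the unit on the left, so that `ℤ.suc (+ i)`
-- reduces to `+ suc i`.
retreat : Point → Step → Point
retreat (i , j) west       = ℤ.suc i  , j
retreat (i , j) north-east = ℤ.pred i , ℤ.pred j
retreat (i , j) east       = ℤ.pred i , j
retreat (i , j) south-west = ℤ.suc i  , ℤ.suc j

suc[i+-1]≡i : ∀ i → ℤ.suc (i ℤ.+ -1ℤ) ≡ i
suc[i+-1]≡i i = trans (cong ℤ.suc (ℤ.+-comm i -1ℤ)) (ℤ.suc-pred i)

pred[i+1]≡i : ∀ i → ℤ.pred (i ℤ.+ + 1) ≡ i
pred[i+1]≡i i = trans (cong ℤ.pred (ℤ.+-comm i (+ 1))) (ℤ.pred-suc i)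

suc[i]-1≡i : ∀ i → ℤ.suc i ℤ.+ -1ℤ ≡ i
suc[i]-1≡i i = trans (ℤ.+-comm (ℤ.suc i) -1ℤ) (ℤ.pred-suc i)

pred[i]+1≡i : ∀ i → ℤ.pred i ℤ.+ + 1 ≡ i
pred[i]+1≡i i = trans (ℤ.+-comm (ℤ.pred i) (+ 1)) (ℤ.suc-pred i)

retreat-move : ∀ q s → retreat (move q s) s ≡ q
retreat-move (i , j) west       = cong₂ _,_ (suc[i+-1]≡i i) (ℤ.+-identityʳ j)
retreat-move (i , j) north-east = cong₂ _,_ (pred[i+1]≡i i) (pred[i+1]≡i j)
retreat-move (i , j) east       = cong₂ _,_ (pred[i+1]≡i i) (ℤ.+-identityʳ j)
retreat-move (i , j) south-west = cong₂ _,_ (suc[i+-1]≡i i) (suc[i+-1]≡i j)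

move-retreat : ∀ p s → move (retreat p s) s ≡ p
move-retreat (i , j) west       = cong₂ _,_ (suc[i]-1≡i i) (ℤ.+-identityʳ j)
move-retreat (i , j) north-east = cong₂ _,_ (pred[i]+1≡i i) (pred[i]+1≡i j)
move-retreat (i , j) east       = cong₂ _,_ (pred[i]+1≡i i) (ℤ.+-identityʳ j)
move-retreat (i , j) south-west = cong₂ _,_ (suc[i]-1≡i i) (suc[i]-1≡i j)

-- Each side is 1 exactly when `q` and `p` lie in the quadrant and `s` carries `q` to `p`, and 0
-- otherwise.
one-step : ∀ q p s → guard q (walks 0 (move q s) p) ≡ guard p (walks 0 q (retreat p s))
one-step q p s = split (inQuadrant? q) (inQuadrant? p)
  where
  split : (d : Dec (InQuadrant q)) (e : Dec (InQuadrant p)) →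
    onlyIf d (walks 0 (move q s) p) ≡ onlyIf e (walks 0 q (retreat p s))
  split (yes q∈) (yes p∈) =
    length-filter-singleton (walkBetween? (move q s) p) (walkBetween? q (retreat p s))
      (λ { (_ , refl) → q∈ ∷ [] , sym (retreat-move q s) })
      (λ { (_ , refl) → subst InQuadrant (sym (move-retreat p s)) p∈ ∷ [] , move-retreat p s })
  split (yes q∈) (no p∉)  =
    cong length (filter-none (walkBetween? (move q s) p) ((λ { (mq∈ ∷ _ , refl) → p∉ mq∈ }) ∷ []))
  split (no q∉)  (yes p∈) =
    sym (cong length (filter-none (walkBetween? q (retreat p s)) ((λ { (q∈ ∷ _ , _) → q∉ q∈ }) ∷ [])))
  split (no _)   (no _)   = refl

-- `stepSequences` grows at the front, so the last step is reached by induction: remove the first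
-- step, split the last one off the rest, exchange the two sums and restore the first step.
walks-last : ∀ m q p → walks (suc m) q p ≡ guard p (sum (map (λ s → walks m q (retreat p s)) steps))
walks-last zero q p = begin
  walks 1 q p
    ≡⟨ walks-first 0 q p ⟩
  guard q (sum (map (λ s → walks 0 (move q s) p) steps))
    ≡⟨ onlyIf-sum (inQuadrant? q) (λ s → walks 0 (move q s) p) steps ⟩
  sum (map (λ s → guard q (walks 0 (move q s) p)) steps)
    ≡⟨ sum-map-cong (one-step q p) steps ⟩
  sum (map (λ s → guard p (walks 0 q (retreat p s))) steps)
    ≡⟨ onlyIf-sum (inQuadrant? p) (λ s → walks 0 q (retreat p s)) steps ⟨
  guard p (sum (map (λ s → walks 0 q (retreat p s)) steps)) ∎
walks-last (suc m) q p = begin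
  walks (suc (suc m)) q p
    ≡⟨ walks-first (suc m) q p ⟩
  guard q (sum (map (λ s → walks (suc m) (move q s) p) steps))
    ≡⟨ cong (guard q) (sum-map-cong (λ s → walks-last m (move q s) p) steps) ⟩
  guard q (sum (map (λ s → guard p (sum (map (between s) steps))) steps))
    ≡⟨ cong (guard q) (onlyIf-sum (inQuadrant? p) (λ s → sum (map (between s) steps)) steps) ⟨
  guard q (guard p (sum (map (λ s → sum (map (between s) steps)) steps)))
    ≡⟨ onlyIf-comm (inQuadrant? q) (inQuadrant? p) _ ⟩
  guard p (guard q (sum (map (λ s → sum (map (between s) steps)) steps)))
    ≡⟨ cong (guard p ∘ guard q) (sum-swap between steps steps) ⟩
  guard p (guard q (sum (map (λ t → sum (map (λ s → between s t) steps)) steps)))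
    ≡⟨ cong (guard p) (onlyIf-sum (inQuadrant? q) (λ t → sum (map (λ s → between s t) steps)) steps) ⟩
  guard p (sum (map (λ t → guard q (sum (map (λ s → between s t) steps))) steps))
    ≡⟨ cong (guard p) (sum-map-cong (λ t → walks-first m q (retreat p t)) steps) ⟨
  guard p (sum (map (λ t → walks (suc m) q (retreat p t)) steps)) ∎
  where
  between : Step → Step → ℕ
  between s t = walks m (move q s) (retreat p t)

-- The last-step recursion, with the four predecessor counts as parameters so that each use supplies
-- simplified values. The final `0` is the end of `sum` over `steps`.
F-step : ∀ m i j {a b c d} →
  F m (+ suc i) (+ j) ≡ a → F m (ℤ.pred (+ i)) (ℤ.pred (+ j)) ≡ b →
  F m (ℤ.pred (+ i)) (+ j) ≡ c → F m (+ suc i) (+ suc j) ≡ d →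
  F (suc m) (+ i) (+ j) ≡ a + (b + (c + (d + 0)))
F-step m i j refl refl refl refl = walks-last m origin (+ i , + j)

F-outsideˡ : ∀ m j → F m -1ℤ j ≡ 0
F-outsideˡ zero    j = refl
F-outsideˡ (suc m) j = walks-last m origin (-1ℤ , j)

F-outsideʳ : ∀ m i → F m (+ i) -1ℤ ≡ 0
F-outsideʳ zero    zero    = refl
F-outsideʳ zero    (suc i) = refl
F-outsideʳ (suc m) i       = walks-last m origin (+ i , -1ℤ)

-- Each step moves at most one column east.
F-far : ∀ m {i} j → m < i → F m (+ i) (+ j) ≡ 0
F-far zero    {suc i} j _         = refl
F-far (suc m) {suc i} j (s≤s m<i) = F-step m (suc i) j
  (F-far m j m<2+i) (south j) (F-far m j m<i) (F-far m (suc j) m<2+i)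
  where
  m<2+i = m<n⇒m<1+n (m<n⇒m<1+n m<i)
  -- `ℤ.pred (+ j)` reduces only once `j` is split; at `zero` it is row -1, outside the quadrant.
  south : ∀ j → F m (+ i) (ℤ.pred (+ j)) ≡ 0
  south zero    = F-outsideʳ m i
  south (suc j) = F-far m j m<i

-- Difference sequences of the counts F(n+2k; n, j)

-- On sequences of iterated differences, moving the base point by one acts as 1 + Δ.
shift : (ℕ → ℕ) → ℕ → ℕ
shift a i = a i + a (suc i)

-- Newton's sum of `a i` times n choose i, computed by moving the base point `n` times and reading
-- entry 0.
value : (ℕ → ℕ) → ℕ → ℕ
value a zero    = a 0
value a (suc n) = value (shift a) n

mutual
  -- diff k j i is the i-th forward difference at n = 0 of n ↦ F(n+2k; n, j), and
  -- inflow k j the difference sequence of n ↦ F(n+2k; n, j) + F(n+2k; n, j+1).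
  diff : ℕ → ℕ → ℕ → ℕ
  -- F(n; n, j) is n choose j, since every step must be East or North-East; its differences at 0 are
  -- 1 at index `j` and 0 elsewhere.
  diff zero    zero    zero    = 1
  diff zero    zero    (suc i) = 0
  diff zero    (suc j) zero    = 0
  diff zero    (suc j) (suc i) = diff zero j i
  -- Entry 0 is the value at n = 0, where the inflow is read at n = 1. The later entries form the
  -- difference sequence of the increment from n to n+1; there the inflow is read at n+2, hence two
  -- shifts.
  diff (suc k) j       zero    = shift (inflow k j) 0
  diff (suc k) zero    (suc i) = shift (shift (inflow k zero)) i
  diff (suc k) (suc j) (suc i) = diff (suc k) j i + shift (shift (inflow k (suc j))) i

  inflow : ℕ → ℕ → ℕ → ℕ
  inflow k j i = diff k j i + diff k (suc j) i

value-cong : ∀ {a b} → (∀ i → a i ≡ b i) → ∀ n → value a n ≡ value b n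
value-cong a≗b zero    = a≗b 0
value-cong a≗b (suc n) = value-cong (λ i → cong₂ _+_ (a≗b i) (a≗b (suc i))) n

value-+ : ∀ a b n → value (λ i → a i + b i) n ≡ value a n + value b n
value-+ a b zero    = refl
value-+ a b (suc n) = trans
  (value-cong (λ i → +-interchange (a i) (b i) (a (suc i)) (b (suc i))) n)
  (value-+ (shift a) (shift b) n)

value-0 : ∀ n → value (λ _ → 0) n ≡ 0
value-0 zero    = refl
value-0 (suc n) = value-0 n

-- Induction on `k`, then on `n`. Column n+1 is entered by West or South-West from column n+2 with
-- `k` one less, and by East or North-East from column n with the same `k`. For `k` = 0 the former
-- predecessors are too far away; in column 0 the latter lie outside. The step count is a variable
-- because it is read both as 2(k+1)+n and as 2k+(n+2).
F-value : ∀ k j n m → m ≡ k * 2 + n → F m (+ n) (+ j) ≡ value (diff k j) n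
F-value zero zero    zero _ refl = refl
F-value zero (suc j) zero _ refl = refl
F-value zero j (suc n) _ refl = begin
  F (suc n) (+ suc n) (+ j)
    ≡⟨ F-step n (suc n) j (F-far n j n<2+n) (south j (λ j′ → F-value zero j′ n n refl)) (F-value zero j n n refl)
         (F-far n (suc j) n<2+n) ⟩
  value (diff 0 j ∘ suc) n + (value (diff 0 j) n + 0)
    ≡⟨ regroup (value (diff 0 j ∘ suc) n) (value (diff 0 j) n) ⟩
  value (diff 0 j) n + value (diff 0 j ∘ suc) n
    ≡⟨ value-+ (diff 0 j) (diff 0 j ∘ suc) n ⟨
  value (diff 0 j) (suc n) ∎
  where
  n<2+n : n < suc (suc n)
  n<2+n = m<n⇒m<1+n (s≤s ≤-refl)
  regroup : ∀ a b → a + (b + 0) ≡ b + a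
  regroup = solve-∀
  south : ∀ j → (∀ j′ → F n (+ n) (+ j′) ≡ value (diff 0 j′) n) →
    F n (+ n) (ℤ.pred (+ j)) ≡ value (diff 0 j ∘ suc) n
  south zero    ih = trans (F-outsideʳ n n) (sym (value-0 n))
  south (suc j) ih = ih j
F-value (suc k) j zero _ refl = begin
  F (suc m) (+ 0) (+ j)
    ≡⟨ F-step m 0 j (F-value k j 1 m m≡) (F-outsideˡ m (ℤ.pred (+ j))) (F-outsideˡ m (+ j))
         (F-value k (suc j) 1 m m≡) ⟩
  value (diff k j) 1 + (value (diff k (suc j)) 1 + 0)
    ≡⟨ cong₂ _+_ {value (diff k j) 1} refl (+-identityʳ (value (diff k (suc j)) 1)) ⟩
  value (diff k j) 1 + value (diff k (suc j)) 1
    ≡⟨ value-+ (diff k j) (diff k (suc j)) 1 ⟨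
  value (diff (suc k) j) 0 ∎
  where
  m = suc (k * 2 + 0)
  m≡ : m ≡ k * 2 + 1
  m≡ = sym (+-suc (k * 2) 0)
F-value (suc k) j (suc n) _ refl = begin
  F (suc m) (+ suc n) (+ j)
    ≡⟨ F-step m (suc n) j (F-value k j (suc (suc n)) m m≡′) refl
         (F-value (suc k) j n m m≡) (F-value k (suc j) (suc (suc n)) m m≡′) ⟩
  value (diff k j) (suc (suc n)) + (F m (+ n) (ℤ.pred (+ j)) +
    (value (diff (suc k) j) n + (value (diff k (suc j)) (suc (suc n)) + 0)))
    ≡⟨ regroup (value (diff k j) (suc (suc n))) (F m (+ n) (ℤ.pred (+ j)))
         (value (diff (suc k) j) n) (value (diff k (suc j)) (suc (suc n))) ⟩
  value (diff (suc k) j) n + (F m (+ n) (ℤ.pred (+ j)) +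
    (value (diff k j) (suc (suc n)) + value (diff k (suc j)) (suc (suc n))))
    ≡⟨ cong (λ x → value (diff (suc k) j) n + (F m (+ n) (ℤ.pred (+ j)) + x))
         (sym (value-+ (diff k j) (diff k (suc j)) (suc (suc n)))) ⟩
  value (diff (suc k) j) n + (F m (+ n) (ℤ.pred (+ j)) + value (shift (shift (inflow k j))) n)
    ≡⟨ cong₂ _+_ refl (south j (λ j′ → F-value (suc k) j′ n m m≡)) ⟩
  value (diff (suc k) j) n + value (diff (suc k) j ∘ suc) n
    ≡⟨ value-+ (diff (suc k) j) (diff (suc k) j ∘ suc) n ⟨
  value (diff (suc k) j) (suc n) ∎
  where
  m = suc (k * 2 + suc n)
  m≡ : m ≡ suc k * 2 + n
  m≡ = cong suc (+-suc (k * 2) n)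
  m≡′ : m ≡ k * 2 + suc (suc n)
  m≡′ = sym (+-suc (k * 2) (suc n))
  regroup : ∀ a b c d → a + (b + (c + (d + 0))) ≡ c + (b + (a + d))
  regroup = solve-∀
  south : ∀ j → (∀ j′ → F m (+ n) (+ j′) ≡ value (diff (suc k) j′) n) →
    F m (+ n) (ℤ.pred (+ j)) + value (shift (shift (inflow k j))) n ≡ value (diff (suc k) j ∘ suc) n
  south zero    ih = cong₂ _+_ (F-outsideʳ m n) refl
  south (suc j) ih = trans
    (cong₂ _+_ (ih j) refl)
    (sym (value-+ (diff (suc k) j) (shift (shift (inflow k (suc j)))) n))

-- Embedding the naturals in the rationals

toℚᵘ-/ : ∀ p d → toℚᵘ (p / suc d) ℚᵘ.≃ mkℚᵘ p d
toℚᵘ-/ p d = ℚ.toℚᵘ-fromℚᵘ (mkℚᵘ p d)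

-- `_/_` normalises by a gcd, which is stuck on variables, so the identity is checked on
-- unnormalised fractions.
fromℕ-+ : ∀ m n → fromℕ (m + n) ≡ fromℕ m ℚ.+ fromℕ n
fromℕ-+ m n = ℚ.toℚᵘ-injective (ℚᵘ.≃-trans (toℚᵘ-/ (+ (m + n)) 0) (ℚᵘ.≃-sym
  (ℚᵘ.≃-trans (ℚ.toℚᵘ-homo-+ (fromℕ m) (fromℕ n))
  (ℚᵘ.≃-trans (ℚᵘ.+-cong (toℚᵘ-/ (+ m) 0) (toℚᵘ-/ (+ n) 0))
              (ℚᵘ.*≡* (cong (ℤ._* 1ℤ) (cong₂ ℤ._+_ (ℤ.*-identityʳ (+ m)) (ℤ.*-identityʳ (+ n)))))))))

fromℕ-* : ∀ m n → fromℕ (m * n) ≡ fromℕ m ℚ.* fromℕ n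
fromℕ-* m n = ℚ.toℚᵘ-injective (ℚᵘ.≃-trans (toℚᵘ-/ (+ (m * n)) 0) (ℚᵘ.≃-sym
  (ℚᵘ.≃-trans (ℚ.toℚᵘ-homo-* (fromℕ m) (fromℕ n))
  (ℚᵘ.≃-trans (ℚᵘ.*-cong (toℚᵘ-/ (+ m) 0) (toℚᵘ-/ (+ n) 0))
              (ℚᵘ.*≡* (cong (ℤ._* 1ℤ) (sym (ℤ.pos-* m n))))))))

fromℕ-*-1/ : ∀ n .{{_ : NonZero n}} → fromℕ n ℚ.* (+ 1 / n) ≡ 1ℚ
fromℕ-*-1/ n@(suc d) = ℚ.toℚᵘ-injective
  (ℚᵘ.≃-trans (ℚ.toℚᵘ-homo-* (fromℕ n) (+ 1 / n))
  (ℚᵘ.≃-trans (ℚᵘ.*-cong (toℚᵘ-/ (+ n) 0) (toℚᵘ-/ (+ 1) d))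
              (ℚᵘ.*≡* (trans (trans (ℤ.*-identityʳ (+ n ℤ.* 1ℤ)) (ℤ.*-identityʳ (+ n)))
                (sym (trans (ℤ.*-identityˡ (+ suc (d + 0))) (cong (λ m → + suc m) (+-identityʳ d))))))))

-- Turns a product equal to 1, the form in which the leading coefficient is found, into a literal
-- fraction.
1/-unique : ∀ n .{{_ : NonZero n}} {y} → fromℕ n ℚ.* y ≡ 1ℚ → y ≡ + 1 / n
1/-unique n {y} ny≡1 = begin
  y                               ≡⟨ ℚ.*-identityˡ y ⟨
  1ℚ ℚ.* y                        ≡⟨ cong (ℚ._* y) (fromℕ-*-1/ n) ⟨
  fromℕ n ℚ.* (+ 1 / n) ℚ.* y     ≡⟨ swap (fromℕ n) (+ 1 / n) y ⟩
  (+ 1 / n) ℚ.* (fromℕ n ℚ.* y)   ≡⟨ cong ((+ 1 / n) ℚ.*_) ny≡1 ⟩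
  (+ 1 / n) ℚ.* 1ℚ                ≡⟨ ℚ.*-identityʳ (+ 1 / n) ⟩
  + 1 / n ∎
  where
  swap : ∀ a b c → a ℚ.* b ℚ.* c ≡ b ℚ.* (a ℚ.* c)
  swap = solve 3 (λ a b c → a :* b :* c := b :* (a :* c)) refl

-- Coefficients, evaluation and division by X + 1

coeff-⊕ : ∀ p q i → coeff (p ⊕ q) i ≡ coeff p i ℚ.+ coeff q i
coeff-⊕ []      q       i       = sym (ℚ.+-identityˡ (coeff q i))
coeff-⊕ (a ∷ p) []      i       = sym (ℚ.+-identityʳ (coeff (a ∷ p) i))
coeff-⊕ (a ∷ p) (b ∷ q) zero    = refl
coeff-⊕ (a ∷ p) (b ∷ q) (suc i) = coeff-⊕ p q i

coeff-scale : ∀ c p i → coeff (map (c ℚ.*_) p) i ≡ c ℚ.* coeff p i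
coeff-scale c []      i       = sym (ℚ.*-zeroʳ c)
coeff-scale c (a ∷ p) zero    = refl
coeff-scale c (a ∷ p) (suc i) = coeff-scale c p i

eval-⊕ : ∀ p q x → eval (p ⊕ q) x ≡ eval p x ℚ.+ eval q x
eval-⊕ []      q       x = sym (ℚ.+-identityˡ (eval q x))
eval-⊕ (a ∷ p) []      x = sym (ℚ.+-identityʳ (eval (a ∷ p) x))
eval-⊕ (a ∷ p) (b ∷ q) x = trans (cong (λ e → a ℚ.+ b ℚ.+ x ℚ.* e) (eval-⊕ p q x))
  (solve 5 (λ a b x e f → a :+ b :+ x :* (e :+ f) := (a :+ x :* e) :+ (b :+ x :* f)) refl
    a b x (eval p x) (eval q x))

eval-scale : ∀ c p x → eval (map (c ℚ.*_) p) x ≡ c ℚ.* eval p x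
eval-scale c []      x = sym (ℚ.*-zeroʳ c)
eval-scale c (a ∷ p) x = trans (cong (λ e → c ℚ.* a ℚ.+ x ℚ.* e) (eval-scale c p x))
  (solve 4 (λ c a x e → c :* a :+ x :* (c :* e) := c :* (a :+ x :* e)) refl c a x (eval p x))

eval-⊛ : ∀ p q x → eval (p ⊛ q) x ≡ eval p x ℚ.* eval q x
eval-⊛ []      q x = sym (ℚ.*-zeroˡ (eval q x))
eval-⊛ (a ∷ p) q x = begin
  eval (map (a ℚ.*_) q ⊕ (0ℚ ∷ p ⊛ q)) x
    ≡⟨ eval-⊕ (map (a ℚ.*_) q) (0ℚ ∷ p ⊛ q) x ⟩
  eval (map (a ℚ.*_) q) x ℚ.+ (0ℚ ℚ.+ x ℚ.* eval (p ⊛ q) x)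
    ≡⟨ cong₂ (λ e f → e ℚ.+ (0ℚ ℚ.+ x ℚ.* f)) (eval-scale a q x) (eval-⊛ p q x) ⟩
  a ℚ.* eval q x ℚ.+ (0ℚ ℚ.+ x ℚ.* (eval p x ℚ.* eval q x))
    ≡⟨ solve 4 (λ a x e f → a :* f :+ (con 0ℚ :+ x :* (e :* f)) := (a :+ x :* e) :* f) refl
         a x (eval p x) (eval q x) ⟩
  (a ℚ.+ x ℚ.* eval p x) ℚ.* eval q x ∎

coeff-linear-⊛ : ∀ c r q i →
  coeff ((c ∷ r ∷ []) ⊛ q) (suc i) ≡ c ℚ.* coeff q (suc i) ℚ.+ r ℚ.* coeff q i
coeff-linear-⊛ c r q i = begin
  coeff (map (c ℚ.*_) q ⊕ (0ℚ ∷ (map (r ℚ.*_) q ⊕ (0ℚ ∷ [])))) (suc i)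
    ≡⟨ coeff-⊕ (map (c ℚ.*_) q) _ (suc i) ⟩
  coeff (map (c ℚ.*_) q) (suc i) ℚ.+ coeff (map (r ℚ.*_) q ⊕ (0ℚ ∷ [])) i
    ≡⟨ cong₂ ℚ._+_ (coeff-scale c q (suc i)) (coeff-⊕ (map (r ℚ.*_) q) (0ℚ ∷ []) i) ⟩
  c ℚ.* coeff q (suc i) ℚ.+ (coeff (map (r ℚ.*_) q) i ℚ.+ coeff (0ℚ ∷ []) i)
    ≡⟨ cong (c ℚ.* coeff q (suc i) ℚ.+_)
         (trans (cong₂ ℚ._+_ (coeff-scale r q i) (zero-coeff i)) (ℚ.+-identityʳ _)) ⟩
  c ℚ.* coeff q (suc i) ℚ.+ r ℚ.* coeff q i ∎
  where
  zero-coeff : ∀ i → coeff (0ℚ ∷ []) i ≡ 0ℚ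
  zero-coeff zero    = refl
  zero-coeff (suc i) = refl

-1ℚ : ℚ
-1ℚ = ℚ.- 1ℚ

-- Synthetic division at −1: the quotient of a ∷ p has p(−1) as its constant term.
quotient-X+1 : Polynomial → Polynomial
quotient-X+1 []      = []
quotient-X+1 (a ∷ p) = eval p -1ℚ ∷ quotient-X+1 p

-- For p = a + X p' with p' = q'(X+1) + r, one has p = (X q' + r)(X+1) + (a - r), where r = p'(-1).
-- The remainder enters only the constant coefficient, which is therefore stated apart.
remainder-X+1 : ∀ p →
  coeff p 0 ≡ coeff (quotient-X+1 p ⊛ X+1) 0 ℚ.+ eval p -1ℚ ×
  (∀ i → coeff p (suc i) ≡ coeff (quotient-X+1 p ⊛ X+1) (suc i))
remainder-X+1 []      = refl , λ _ → refl
remainder-X+1 (a ∷ p) =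
  solve 2 (λ a r → a := (r :* con 1ℚ :+ con 0ℚ) :+ (a :+ con -1ℚ :* r)) refl a r , step
  where
  r = eval p -1ℚ
  q = quotient-X+1 p ⊛ X+1
  step : ∀ i → coeff p i ≡ coeff ((r ℚ.* 1ℚ ∷ []) ⊕ q) i
  step zero    = trans (proj₁ (remainder-X+1 p)) (trans
    (solve 2 (λ r c → c :+ r := r :* con 1ℚ :+ c) refl r (coeff q 0))
    (sym (coeff-⊕ (r ℚ.* 1ℚ ∷ []) q 0)))
  step (suc i) = trans (proj₂ (remainder-X+1 p) i) (trans
    (sym (ℚ.+-identityˡ (coeff q (suc i))))
    (sym (coeff-⊕ (r ℚ.* 1ℚ ∷ []) q (suc i))))

root⇒X+1∣ : ∀ p → eval p -1ℚ ≡ 0ℚ → X+1 ∣ p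
root⇒X+1∣ p root = quotient-X+1 p , λ
  { zero    → sym (trans (proj₁ (remainder-X+1 p))
                  (trans (cong (coeff (quotient-X+1 p ⊛ X+1) 0 ℚ.+_) root) (ℚ.+-identityʳ _)))
  ; (suc i) → sym (proj₂ (remainder-X+1 p) i) }

-- Binomial polynomials

binomial : ℕ → Polynomial
binomial zero    = 1ℚ ∷ []
binomial (suc i) = (ℚ.- fromℕ i ℚ.* (+ 1 / suc i) ∷ + 1 / suc i ∷ []) ⊛ binomial i

eval-binomial-suc : ∀ i x →
  eval (binomial (suc i)) x ≡ (+ 1 / suc i) ℚ.* ((x ℚ.- fromℕ i) ℚ.* eval (binomial i) x)
eval-binomial-suc i x = trans (eval-⊛ (ℚ.- fromℕ i ℚ.* (+ 1 / suc i) ∷ + 1 / suc i ∷ []) (binomial i) x)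
  (solve 4 (λ i r x e → (:- i :* r :+ x :* (r :+ x :* con 0ℚ)) :* e := r :* ((x :- i) :* e)) refl
    (fromℕ i) (+ 1 / suc i) x (eval (binomial i) x))

suc*eval-binomial : ∀ i x →
  fromℕ (suc i) ℚ.* eval (binomial (suc i)) x ≡ (x ℚ.- fromℕ i) ℚ.* eval (binomial i) x
suc*eval-binomial i x = begin
  fromℕ (suc i) ℚ.* eval (binomial (suc i)) x
    ≡⟨ cong (fromℕ (suc i) ℚ.*_) (eval-binomial-suc i x) ⟩
  fromℕ (suc i) ℚ.* ((+ 1 / suc i) ℚ.* y)
    ≡⟨ ℚ.*-assoc (fromℕ (suc i)) (+ 1 / suc i) y ⟨
  fromℕ (suc i) ℚ.* (+ 1 / suc i) ℚ.* y
    ≡⟨ cong (ℚ._* y) (fromℕ-*-1/ (suc i)) ⟩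
  1ℚ ℚ.* y
    ≡⟨ ℚ.*-identityˡ y ⟩
  y ∎
  where y = (x ℚ.- fromℕ i) ℚ.* eval (binomial i) x

-- Stated for rational `x`, as it is also needed at -1. At x + 1 the factor x - (i+1) becomes x - i,
-- and (x - i) C(x,i) = (i+1) C(x,i+1) removes `e₀`.
pascal : ∀ i x →
  eval (binomial (suc i)) (x ℚ.+ 1ℚ) ≡ eval (binomial (suc i)) x ℚ.+ eval (binomial i) x
pascal zero x =
  solve 1 (λ x → lhs (x :+ con 1ℚ) := lhs x :+ (con 1ℚ :+ x :* con 0ℚ)) refl x
  where
  lhs = λ x → (con 0ℚ :* con 1ℚ :+ con 0ℚ) :+ x :* ((con 1ℚ :* con 1ℚ) :+ x :* con 0ℚ)
pascal (suc i) x = begin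
  eval (binomial (suc (suc i))) (x ℚ.+ 1ℚ)
    ≡⟨ eval-binomial-suc (suc i) (x ℚ.+ 1ℚ) ⟩
  r ℚ.* ((x ℚ.+ 1ℚ ℚ.- s) ℚ.* eval (binomial (suc i)) (x ℚ.+ 1ℚ))
    ≡⟨ cong (λ y → r ℚ.* ((x ℚ.+ 1ℚ ℚ.- s) ℚ.* y)) (pascal i x) ⟩
  r ℚ.* ((x ℚ.+ 1ℚ ℚ.- s) ℚ.* (e₁ ℚ.+ e₀))
    ≡⟨ cong (λ s → r ℚ.* ((x ℚ.+ 1ℚ ℚ.- s) ℚ.* (e₁ ℚ.+ e₀))) (fromℕ-+ 1 i) ⟩
  r ℚ.* ((x ℚ.+ 1ℚ ℚ.- (1ℚ ℚ.+ t)) ℚ.* (e₁ ℚ.+ e₀))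
    ≡⟨ solve 5 (λ r x t e₁ e₀ →
         r :* ((x :+ con 1ℚ :- (con 1ℚ :+ t)) :* (e₁ :+ e₀)) :=
         r :* ((x :- t) :* e₁ :+ (x :- t) :* e₀)) refl r x t e₁ e₀ ⟩
  r ℚ.* ((x ℚ.- t) ℚ.* e₁ ℚ.+ (x ℚ.- t) ℚ.* e₀)
    ≡⟨ cong (λ y → r ℚ.* ((x ℚ.- t) ℚ.* e₁ ℚ.+ y)) (suc*eval-binomial i x) ⟨
  r ℚ.* ((x ℚ.- t) ℚ.* e₁ ℚ.+ s ℚ.* e₁)
    ≡⟨ cong (λ s → r ℚ.* ((x ℚ.- t) ℚ.* e₁ ℚ.+ s ℚ.* e₁)) (fromℕ-+ 1 i) ⟩
  r ℚ.* ((x ℚ.- t) ℚ.* e₁ ℚ.+ (1ℚ ℚ.+ t) ℚ.* e₁)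
    -- The total factor x + 1 of `e₁` is regrouped as (x - (i+1)) + (i+2); the second summand
    -- cancels `r`.
    ≡⟨ solve 4 (λ r x t e₁ →
         r :* ((x :- t) :* e₁ :+ (con 1ℚ :+ t) :* e₁) :=
         r :* ((x :- (con 1ℚ :+ t)) :* e₁) :+ (con 1ℚ :+ (con 1ℚ :+ t)) :* r :* e₁) refl r x t e₁ ⟩
  r ℚ.* ((x ℚ.- (1ℚ ℚ.+ t)) ℚ.* e₁) ℚ.+ (1ℚ ℚ.+ (1ℚ ℚ.+ t)) ℚ.* r ℚ.* e₁
    ≡⟨ cong (λ s → r ℚ.* ((x ℚ.- s) ℚ.* e₁) ℚ.+ (1ℚ ℚ.+ s) ℚ.* r ℚ.* e₁) (fromℕ-+ 1 i) ⟨
  r ℚ.* ((x ℚ.- s) ℚ.* e₁) ℚ.+ (1ℚ ℚ.+ s) ℚ.* r ℚ.* e₁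
    ≡⟨ cong (λ u → r ℚ.* ((x ℚ.- s) ℚ.* e₁) ℚ.+ u ℚ.* r ℚ.* e₁) (fromℕ-+ 1 (suc i)) ⟨
  r ℚ.* ((x ℚ.- s) ℚ.* e₁) ℚ.+ fromℕ (suc (suc i)) ℚ.* r ℚ.* e₁
    ≡⟨ cong₂ ℚ._+_ (sym (eval-binomial-suc (suc i) x))
         (trans (cong (ℚ._* e₁) (fromℕ-*-1/ (suc (suc i)))) (ℚ.*-identityˡ e₁)) ⟩
  eval (binomial (suc (suc i))) x ℚ.+ e₁ ∎
  where
  r  = + 1 / suc (suc i)
  s  = fromℕ (suc i)
  t  = fromℕ i
  e₁ = eval (binomial (suc i)) x
  e₀ = eval (binomial i) x

eval-binomial-0 : ∀ i → eval (binomial (suc i)) 0ℚ ≡ 0ℚ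
eval-binomial-0 zero    = refl
eval-binomial-0 (suc i) = trans (eval-binomial-suc (suc i) 0ℚ)
  (trans (cong (λ e → (+ 1 / suc (suc i)) ℚ.* ((0ℚ ℚ.- fromℕ (suc i)) ℚ.* e)) (eval-binomial-0 i))
         (solve 2 (λ r y → r :* (y :* con 0ℚ) := con 0ℚ) refl (+ 1 / suc (suc i)) (0ℚ ℚ.- fromℕ (suc i))))

coeff-binomial-above : ∀ {i j} → i < j → coeff (binomial i) j ≡ 0ℚ
coeff-binomial-above {zero}  {suc j} _         = refl
coeff-binomial-above {suc i} {suc j} (s≤s i<j) = trans
  (coeff-linear-⊛ (ℚ.- fromℕ i ℚ.* (+ 1 / suc i)) (+ 1 / suc i) (binomial i) j)
  (trans (cong₂ (λ c d → (ℚ.- fromℕ i ℚ.* (+ 1 / suc i)) ℚ.* c ℚ.+ (+ 1 / suc i) ℚ.* d)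
           (coeff-binomial-above (m<n⇒m<1+n i<j)) (coeff-binomial-above i<j))
         (solve 2 (λ x y → x :* con 0ℚ :+ y :* con 0ℚ := con 0ℚ) refl
           (ℚ.- fromℕ i ℚ.* (+ 1 / suc i)) (+ 1 / suc i)))

coeff-binomial-top : ∀ i → coeff (binomial i) i ℚ.* fromℕ (i !) ≡ 1ℚ
coeff-binomial-top zero    = refl
coeff-binomial-top (suc i) = begin
  coeff (binomial (suc i)) (suc i) ℚ.* fromℕ (suc i * i !)
    ≡⟨ cong₂ ℚ._*_ (coeff-linear-⊛ c r (binomial i) i) (fromℕ-* (suc i) (i !)) ⟩
  (c ℚ.* coeff (binomial i) (suc i) ℚ.+ r ℚ.* b) ℚ.* (fromℕ (suc i) ℚ.* fromℕ (i !))
    ≡⟨ cong (λ z → (c ℚ.* z ℚ.+ r ℚ.* b) ℚ.* (fromℕ (suc i) ℚ.* fromℕ (i !)))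
         (coeff-binomial-above (n<1+n i)) ⟩
  (c ℚ.* 0ℚ ℚ.+ r ℚ.* b) ℚ.* (fromℕ (suc i) ℚ.* fromℕ (i !))
    ≡⟨ solve 5 (λ c r b s f → (c :* con 0ℚ :+ r :* b) :* (s :* f) := (s :* r) :* (b :* f)) refl
         c r b (fromℕ (suc i)) (fromℕ (i !)) ⟩
  (fromℕ (suc i) ℚ.* r) ℚ.* (b ℚ.* fromℕ (i !))
    ≡⟨ cong₂ ℚ._*_ (fromℕ-*-1/ (suc i)) (coeff-binomial-top i) ⟩
  1ℚ ∎
  where
  r = + 1 / suc i
  c = ℚ.- fromℕ i ℚ.* r
  b = coeff (binomial i) i

-- Truncated Newton series

newton : ℕ → (ℕ → ℕ) → Polynomial
newton zero    a = fromℕ (a 0) ∷ []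
newton (suc d) a = newton d a ⊕ map (fromℕ (a (suc d)) ℚ.*_) (binomial (suc d))

coeff-newton-suc : ∀ d a i → coeff (newton (suc d) a) i ≡
  coeff (newton d a) i ℚ.+ fromℕ (a (suc d)) ℚ.* coeff (binomial (suc d)) i
coeff-newton-suc d a i = trans (coeff-⊕ (newton d a) _ i)
  (cong (coeff (newton d a) i ℚ.+_) (coeff-scale (fromℕ (a (suc d))) (binomial (suc d)) i))

coeff-newton-above : ∀ d a {i} → d < i → coeff (newton d a) i ≡ 0ℚ
coeff-newton-above zero    a {suc i} _   = refl
coeff-newton-above (suc d) a {i}     d<i = begin
  coeff (newton (suc d) a) i
    ≡⟨ coeff-newton-suc d a i ⟩
  coeff (newton d a) i ℚ.+ c ℚ.* coeff (binomial (suc d)) i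
    ≡⟨ cong₂ (λ y z → y ℚ.+ c ℚ.* z) (coeff-newton-above d a (<⇒≤ d<i)) (coeff-binomial-above d<i) ⟩
  0ℚ ℚ.+ c ℚ.* 0ℚ
    ≡⟨ solve 1 (λ c → con 0ℚ :+ c :* con 0ℚ := con 0ℚ) refl c ⟩
  0ℚ ∎
  where c = fromℕ (a (suc d))

coeff-newton-top : ∀ d a → coeff (newton d a) d ℚ.* fromℕ (d !) ≡ fromℕ (a d)
coeff-newton-top zero    a = ℚ.*-identityʳ (fromℕ (a 0))
coeff-newton-top (suc d) a = begin
  coeff (newton (suc d) a) (suc d) ℚ.* f
    ≡⟨ cong (ℚ._* f) (coeff-newton-suc d a (suc d)) ⟩
  (coeff (newton d a) (suc d) ℚ.+ c ℚ.* b) ℚ.* f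
    ≡⟨ cong (λ y → (y ℚ.+ c ℚ.* b) ℚ.* f) (coeff-newton-above d a (n<1+n d)) ⟩
  (0ℚ ℚ.+ c ℚ.* b) ℚ.* f
    ≡⟨ solve 3 (λ c b f → (con 0ℚ :+ c :* b) :* f := c :* (b :* f)) refl c b f ⟩
  c ℚ.* (b ℚ.* f)
    ≡⟨ trans (cong (c ℚ.*_) (coeff-binomial-top (suc d))) (ℚ.*-identityʳ c) ⟩
  c ∎
  where
  c = fromℕ (a (suc d))
  b = coeff (binomial (suc d)) (suc d)
  f = fromℕ (suc d !)

eval-newton-suc : ∀ d a x → eval (newton (suc d) a) x ≡
  eval (newton d a) x ℚ.+ fromℕ (a (suc d)) ℚ.* eval (binomial (suc d)) x
eval-newton-suc d a x = trans (eval-⊕ (newton d a) _ x)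
  (cong (eval (newton d a) x ℚ.+_) (eval-scale (fromℕ (a (suc d))) (binomial (suc d)) x))

eval-newton-0 : ∀ d a → eval (newton d a) 0ℚ ≡ fromℕ (a 0)
eval-newton-0 zero    a = ℚ.+-identityʳ (fromℕ (a 0))
eval-newton-0 (suc d) a = begin
  eval (newton (suc d) a) 0ℚ
    ≡⟨ eval-newton-suc d a 0ℚ ⟩
  eval (newton d a) 0ℚ ℚ.+ fromℕ (a (suc d)) ℚ.* eval (binomial (suc d)) 0ℚ
    ≡⟨ cong₂ (λ y z → y ℚ.+ fromℕ (a (suc d)) ℚ.* z) (eval-newton-0 d a) (eval-binomial-0 d) ⟩
  fromℕ (a 0) ℚ.+ fromℕ (a (suc d)) ℚ.* 0ℚ
    ≡⟨ solve 2 (λ x y → x :+ y :* con 0ℚ := x) refl (fromℕ (a 0)) (fromℕ (a (suc d))) ⟩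
  fromℕ (a 0) ∎

eval-newton-+ : ∀ d a b x →
  eval (newton d (λ i → a i + b i)) x ≡ eval (newton d a) x ℚ.+ eval (newton d b) x
eval-newton-+ zero    a b x = trans (cong (ℚ._+ x ℚ.* 0ℚ) (fromℕ-+ (a 0) (b 0)))
  (solve 3 (λ a b x → a :+ b :+ x :* con 0ℚ := (a :+ x :* con 0ℚ) :+ (b :+ x :* con 0ℚ)) refl
    (fromℕ (a 0)) (fromℕ (b 0)) x)
eval-newton-+ (suc d) a b x = begin
  eval (newton (suc d) (λ i → a i + b i)) x
    ≡⟨ eval-newton-suc d (λ i → a i + b i) x ⟩
  eval (newton d (λ i → a i + b i)) x ℚ.+ fromℕ (a (suc d) + b (suc d)) ℚ.* e
    ≡⟨ cong₂ (λ y z → y ℚ.+ z ℚ.* e) (eval-newton-+ d a b x) (fromℕ-+ (a (suc d)) (b (suc d))) ⟩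
  (u ℚ.+ v) ℚ.+ (fromℕ (a (suc d)) ℚ.+ fromℕ (b (suc d))) ℚ.* e
    ≡⟨ solve 5 (λ u v y z e → (u :+ v) :+ (y :+ z) :* e := (u :+ y :* e) :+ (v :+ z :* e)) refl
         u v (fromℕ (a (suc d))) (fromℕ (b (suc d))) e ⟩
  (u ℚ.+ fromℕ (a (suc d)) ℚ.* e) ℚ.+ (v ℚ.+ fromℕ (b (suc d)) ℚ.* e)
    ≡⟨ cong₂ ℚ._+_ (eval-newton-suc d a x) (eval-newton-suc d b x) ⟨
  eval (newton (suc d) a) x ℚ.+ eval (newton (suc d) b) x ∎
  where
  e = eval (binomial (suc d)) x
  u = eval (newton d a) x
  v = eval (newton d b) x

-- By Pascal's rule the term of index i+1 at x + 1 yields terms of index i+1 and i at x. Truncation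
-- at `d` loses only `a (suc d)` times `binomial d`; adding that term lets the induction on `d` run
-- for arbitrary `a`.
eval-newton-shift-error : ∀ d a x →
  eval (newton d a) (x ℚ.+ 1ℚ) ℚ.+ fromℕ (a (suc d)) ℚ.* eval (binomial d) x ≡ eval (newton d (shift a)) x
eval-newton-shift-error zero a x = trans
  (solve 3 (λ a b x → (a :+ (x :+ con 1ℚ) :* con 0ℚ) :+ b :* (con 1ℚ :+ x :* con 0ℚ) :=
                      (a :+ b) :+ x :* con 0ℚ) refl (fromℕ (a 0)) (fromℕ (a 1)) x)
  (cong (ℚ._+ x ℚ.* 0ℚ) (sym (fromℕ-+ (a 0) (a 1))))
eval-newton-shift-error (suc d) a x = begin
  eval (newton (suc d) a) (x ℚ.+ 1ℚ) ℚ.+ a₂ ℚ.* e₁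
    ≡⟨ cong (ℚ._+ a₂ ℚ.* e₁) (eval-newton-suc d a (x ℚ.+ 1ℚ)) ⟩
  u ℚ.+ a₁ ℚ.* eval (binomial (suc d)) (x ℚ.+ 1ℚ) ℚ.+ a₂ ℚ.* e₁
    ≡⟨ cong (λ y → u ℚ.+ a₁ ℚ.* y ℚ.+ a₂ ℚ.* e₁) (pascal d x) ⟩
  u ℚ.+ a₁ ℚ.* (e₁ ℚ.+ e₀) ℚ.+ a₂ ℚ.* e₁
    ≡⟨ solve 5 (λ u a₁ a₂ e₁ e₀ →
         u :+ a₁ :* (e₁ :+ e₀) :+ a₂ :* e₁ := (u :+ a₁ :* e₀) :+ (a₁ :+ a₂) :* e₁) refl u a₁ a₂ e₁ e₀ ⟩
  (u ℚ.+ a₁ ℚ.* e₀) ℚ.+ (a₁ ℚ.+ a₂) ℚ.* e₁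
    ≡⟨ cong₂ (λ y z → y ℚ.+ z ℚ.* e₁) (eval-newton-shift-error d a x)
         (sym (fromℕ-+ (a (suc d)) (a (suc (suc d))))) ⟩
  eval (newton d (shift a)) x ℚ.+ fromℕ (shift a (suc d)) ℚ.* e₁
    ≡⟨ eval-newton-suc d (shift a) x ⟨
  eval (newton (suc d) (shift a)) x ∎
  where
  a₁ = fromℕ (a (suc d))
  a₂ = fromℕ (a (suc (suc d)))
  e₁ = eval (binomial (suc d)) x
  e₀ = eval (binomial d) x
  u  = eval (newton d a) (x ℚ.+ 1ℚ)

-- For a difference sequence this means that the function is a polynomial of degree at most `d`.
VanishesAbove : ℕ → (ℕ → ℕ) → Set
VanishesAbove d a = ∀ i → d < i → a i ≡ 0

VanishesAbove-+ : ∀ {d a b} → VanishesAbove d a → VanishesAbove d b →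
  VanishesAbove d (λ i → a i + b i)
VanishesAbove-+ va vb i d<i = cong₂ _+_ (va i d<i) (vb i d<i)

VanishesAbove-shift : ∀ {d a} → VanishesAbove d a → VanishesAbove d (shift a)
VanishesAbove-shift va = VanishesAbove-+ va (λ i d<i → va (suc i) (m<n⇒m<1+n d<i))

VanishesAbove-mono : ∀ {c d a} → c ≤ d → VanishesAbove c a → VanishesAbove d a
VanishesAbove-mono c≤d va i d<i = va i (≤-trans (s≤s c≤d) d<i)

VanishesAbove-tail : ∀ {d a} → VanishesAbove d (a ∘ suc) → VanishesAbove (suc d) a
VanishesAbove-tail va (suc i) (s≤s d<i) = va i d<i

eval-newton-shift : ∀ {d a} → VanishesAbove d a → ∀ x →
  eval (newton d a) (x ℚ.+ 1ℚ) ≡ eval (newton d (shift a)) x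
eval-newton-shift {d} {a} va x = begin
  u                                      ≡⟨ solve 2 (λ u e → u := u :+ con 0ℚ :* e) refl u e ⟩
  u ℚ.+ 0ℚ ℚ.* e                         ≡⟨ cong (λ c → u ℚ.+ fromℕ c ℚ.* e) (va (suc d) (n<1+n d)) ⟨
  u ℚ.+ fromℕ (a (suc d)) ℚ.* e          ≡⟨ eval-newton-shift-error d a x ⟩
  eval (newton d (shift a)) x ∎
  where
  u = eval (newton d a) (x ℚ.+ 1ℚ)
  e = eval (binomial d) x

-- Induction on `n` for all `a`: `value` moves the base point by `shift`, and `shift` amounts to
-- evaluating at x + 1.
value-newton : ∀ {d a} → VanishesAbove d a → ∀ n → fromℕ (value a n) ≡ eval (newton d a) (fromℕ n)
value-newton {d} {a} va zero    = sym (eval-newton-0 d a)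
value-newton {d} {a} va (suc n) = begin
  fromℕ (value (shift a) n)              ≡⟨ value-newton (VanishesAbove-shift va) n ⟩
  eval (newton d (shift a)) (fromℕ n)    ≡⟨ eval-newton-shift va (fromℕ n) ⟨
  eval (newton d a) (fromℕ n ℚ.+ 1ℚ) ≡⟨ cong (eval (newton d a))
                                          (trans (ℚ.+-comm (fromℕ n) 1ℚ) (sym (fromℕ-+ 1 n))) ⟩
  eval (newton d a) (fromℕ (suc n)) ∎

-- Degree bounds and leading differences

mutual
  -- The inflow has degree at most 2k+j+1, due to its row j+1, and shifting keeps this bound.
  -- Passing from increments to values adds one, which gives 2(k+1)+j; the increment's term from the
  -- row below meets the same bound.
  diff-vanishesAbove : ∀ k j → VanishesAbove (k * 2 + j) (diff k j)
  diff-vanishesAbove zero    zero    (suc i) _         = refl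
  diff-vanishesAbove zero    (suc j) (suc i) (s≤s j<i) = diff-vanishesAbove zero j i j<i
  diff-vanishesAbove (suc k) zero    = VanishesAbove-tail (shift²-inflow-vanishesAbove k zero)
  diff-vanishesAbove (suc k) (suc j) = VanishesAbove-tail (VanishesAbove-+
    (VanishesAbove-mono (≤-reflexive (cong suc (sym (+-suc (k * 2) j)))) (diff-vanishesAbove (suc k) j))
    (shift²-inflow-vanishesAbove k (suc j)))

  inflow-vanishesAbove : ∀ k j → VanishesAbove (suc (k * 2 + j)) (inflow k j)
  inflow-vanishesAbove k j = VanishesAbove-+
    (VanishesAbove-mono (n≤1+n (k * 2 + j)) (diff-vanishesAbove k j))
    (VanishesAbove-mono (≤-reflexive (+-suc (k * 2) j)) (diff-vanishesAbove k (suc j)))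

  shift²-inflow-vanishesAbove : ∀ k j → VanishesAbove (suc (k * 2 + j)) (shift (shift (inflow k j)))
  shift²-inflow-vanishesAbove k j = VanishesAbove-shift (VanishesAbove-shift (inflow-vanishesAbove k j))

shift-top : ∀ {d a} → VanishesAbove d a → shift a d ≡ a d
shift-top {d} {a} va = trans (cong₂ _+_ {a d} refl (va (suc d) (n<1+n d))) (+-identityʳ (a d))

-- At this index one term survives: `diff k j` and all that `shift` adds lie above their bounds.
shift²-inflow-top : ∀ k j → shift (shift (inflow k j)) (suc (k * 2 + j)) ≡ diff k (suc j) (k * 2 + suc j)
shift²-inflow-top k j = begin
  shift (shift (inflow k j)) d
    ≡⟨ shift-top (VanishesAbove-shift (inflow-vanishesAbove k j)) ⟩
  shift (inflow k j) d
    ≡⟨ shift-top (inflow-vanishesAbove k j) ⟩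
  diff k j d + diff k (suc j) d
    ≡⟨ cong (_+ diff k (suc j) d) (diff-vanishesAbove k j d (n<1+n (k * 2 + j))) ⟩
  diff k (suc j) d
    ≡⟨ cong (diff k (suc j)) (+-suc (k * 2) j) ⟨
  diff k (suc j) (k * 2 + suc j) ∎
  where d = suc (k * 2 + j)

-- The leading difference t(k,j) satisfies t(k+1,j+1) = t(k+1,j) + t(k,j+2) and t(k+1,0) = t(k,1).
-- It is the ballot number counting nonnegative paths with k+j up steps and k down steps; its
-- denominators are multiplied out to stay in the naturals.
diff-top : ∀ k j → diff k j (k * 2 + j) * (k ! * suc (k + j) !) ≡ (k * 2 + j) ! * suc j
diff-top zero j = trans (cong (_* (1 * (suc j !))) (diagonal j)) (rearrange (j !) (suc j))
  where
  diagonal : ∀ j → diff 0 j j ≡ 1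
  diagonal zero    = refl
  diagonal (suc j) = diagonal j
  rearrange : ∀ f s → 1 * (1 * (s * f)) ≡ f * s
  rearrange = solve-∀
diff-top (suc k) zero = begin
  diff (suc k) 0 (suc (suc (k * 2 + 0))) * (suc k * k ! * suc (suc (k + 0)) !)
    ≡⟨ cong₂ (λ t b → t * (suc k * k ! * suc b !)) (shift²-inflow-top k 0) (sym (+-suc k 0)) ⟩
  t * (suc k * k ! * suc (k + 1) !)
    ≡⟨ assoc t (suc k) (k !) (suc (k + 1) !) ⟩
  suc k * (t * (k ! * suc (k + 1) !))
    ≡⟨ cong (suc k *_) (diff-top k 1) ⟩
  suc k * ((k * 2 + 1) ! * 2)
    ≡⟨ cong (λ d → suc k * (d ! * 2)) (+-suc (k * 2) 0) ⟩
  suc k * (suc (k * 2 + 0) ! * 2)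
    ≡⟨ double k (suc (k * 2 + 0) !) ⟩
  suc (suc (k * 2 + 0)) * suc (k * 2 + 0) ! * 1 ∎
  where
  t = diff k 1 (k * 2 + 1)
  assoc : ∀ t k a b → t * (k * a * b) ≡ k * (t * (a * b))
  assoc = solve-∀
  double : ∀ k f → suc k * (f * 2) ≡ suc (suc (k * 2 + 0)) * f * 1
  double = solve-∀
diff-top (suc k) (suc j) = begin
  diff (suc k) (suc j) (suc (suc (k * 2 + suc j))) * (suc k * k ! * suc (suc (k + suc j)) !)
    ≡⟨ cong₂ (λ t b → t * (suc k * k ! * b))
         (cong₂ _+_ (cong (diff (suc k) j ∘ suc) (+-suc (k * 2) j)) (shift²-inflow-top k (suc j)))
         (cong (λ b → suc (suc b) !) (+-suc k j)) ⟩
  (t₁ + t₂) * (suc k * k ! * (suc (suc (suc (k + j))) * b))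
    -- Common denominator (k+1)! (k+j+3)!: the hypothesis for `t₁` lacks the factor k+j+3, the one
    -- for `t₂` the factor k+1.
    ≡⟨ expand t₁ t₂ (suc k) (k !) (suc (suc (suc (k + j)))) b ⟩
  suc (suc (suc (k + j))) * (t₁ * (suc k * k ! * b)) + suc k * (t₂ * (k ! * (suc (suc (suc (k + j))) * b)))
    ≡⟨ cong₂ (λ x y → suc (suc (suc (k + j))) * x + suc k * y) (diff-top (suc k) j) second ⟩
  suc (suc (suc (k + j))) * (d * suc j) + suc k * (d * suc (suc (suc j)))
    ≡⟨ collect k j d ⟩
  suc (suc (suc (k * 2 + j))) * d * suc (suc j)
    ≡⟨ cong (λ e → suc (suc e) ! * suc (suc j)) (+-suc (k * 2) j) ⟨
  suc (suc (k * 2 + suc j)) ! * suc (suc j) ∎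
  where
  t₁ = diff (suc k) j (suc (suc (k * 2 + j)))
  t₂ = diff k (suc (suc j)) (k * 2 + suc (suc j))
  b = suc (suc (k + j)) !
  d = suc (suc (k * 2 + j)) !
  expand : ∀ t₁ t₂ s a c b →
    (t₁ + t₂) * (s * a * (c * b)) ≡ c * (t₁ * (s * a * b)) + s * (t₂ * (a * (c * b)))
  expand = solve-∀
  collect : ∀ k j d → suc (suc (suc (k + j))) * (d * suc j) + suc k * (d * suc (suc (suc j)))
    ≡ suc (suc (suc (k * 2 + j))) * d * suc (suc j)
  collect = solve-∀
  second : t₂ * (k ! * suc (suc (suc (k + j))) !) ≡ d * suc (suc (suc j))
  second = begin
    t₂ * (k ! * suc (suc (suc (k + j))) !)
      ≡⟨ cong (λ c → t₂ * (k ! * suc c !)) (trans (+-suc k (suc j)) (cong suc (+-suc k j))) ⟨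
    t₂ * (k ! * suc (k + suc (suc j)) !)
      ≡⟨ diff-top k (suc (suc j)) ⟩
    (k * 2 + suc (suc j)) ! * suc (suc (suc j))
      ≡⟨ cong (λ c → c ! * suc (suc (suc j))) (trans (+-suc (k * 2) (suc j)) (cong suc (+-suc (k * 2) j))) ⟩
    d * suc (suc (suc j)) ∎

-- The root at -1

newton-shift-at-−1 : ∀ {d a} → VanishesAbove d a → eval (newton d (shift a)) -1ℚ ≡ fromℕ (a 0)
newton-shift-at-−1 {d} {a} va = trans (sym (eval-newton-shift va -1ℚ)) (eval-newton-0 d a)

-- For a = `diff (suc k) j`, evaluation at -1 gives T(a) + T(a ∘ suc) = a 0, because -1 + 1 = 0. The
-- tail alone already gives a 0: its term from the row below vanishes by induction on `j`, and the
-- twice shifted inflow gives entry 0 of the once shifted one. `d` is any sufficient bound so that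
-- all rows share one truncation.
newton-diff-at-−1 : ∀ k j {d} → suc k * 2 + j ≤ d → eval (newton d (diff (suc k) j)) -1ℚ ≡ 0ℚ
newton-diff-at-−1 k j {d} bound = begin
  T (diff (suc k) j)
    ≡⟨ solve 2 (λ t u → t := t :+ u :- u) refl (T (diff (suc k) j)) (T (diff (suc k) j ∘ suc)) ⟩
  T (diff (suc k) j) ℚ.+ T (diff (suc k) j ∘ suc) ℚ.- T (diff (suc k) j ∘ suc)
    ≡⟨ cong₂ ℚ._-_
         (trans (sym (eval-newton-+ d (diff (suc k) j) (diff (suc k) j ∘ suc) -1ℚ))
                (newton-shift-at-−1 (VanishesAbove-mono bound (diff-vanishesAbove (suc k) j))))
         (tail j bound) ⟩
  fromℕ (shift (inflow k j) 0) ℚ.- fromℕ (shift (inflow k j) 0)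
    ≡⟨ ℚ.+-inverseʳ (fromℕ (shift (inflow k j) 0)) ⟩
  0ℚ ∎
  where
  T : (ℕ → ℕ) → ℚ
  T a = eval (newton d a) -1ℚ
  T-shift²-inflow : ∀ j → suc k * 2 + j ≤ d → T (shift (shift (inflow k j))) ≡ fromℕ (shift (inflow k j) 0)
  T-shift²-inflow j bound = newton-shift-at-−1
    (VanishesAbove-mono (<⇒≤ bound) (VanishesAbove-shift (inflow-vanishesAbove k j)))
  tail : ∀ j → suc k * 2 + j ≤ d → T (diff (suc k) j ∘ suc) ≡ fromℕ (shift (inflow k j) 0)
  tail zero    bound = T-shift²-inflow zero bound
  tail (suc j) bound = begin
    T (diff (suc k) (suc j) ∘ suc)
      ≡⟨ eval-newton-+ d (diff (suc k) j) (shift (shift (inflow k (suc j)))) -1ℚ ⟩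
    T (diff (suc k) j) ℚ.+ T (shift (shift (inflow k (suc j))))
      ≡⟨ cong₂ ℚ._+_
           (newton-diff-at-−1 k j (<⇒≤ (subst (_≤ d) (cong (suc ∘ suc) (+-suc (k * 2) j)) bound)))
           (T-shift²-inflow (suc j) bound) ⟩
    0ℚ ℚ.+ fromℕ (shift (inflow k (suc j)) 0)
      ≡⟨ ℚ.+-identityˡ (fromℕ (shift (inflow k (suc j)) 0)) ⟩
    fromℕ (shift (inflow k (suc j)) 0) ∎

-- The polynomials s_k: values, leading coefficient, divisibility

returnPolynomial : ℕ → Polynomial
returnPolynomial k = newton (2 * k) (diff k 0)

-- The recursion uses `k * 2`, which unfolds by two at `suc k`, while the theorem has `2 * k`. The
-- `0` is the row `j`.
2*k≡k*2+0 : ∀ k → 2 * k ≡ k * 2 + 0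
2*k≡k*2+0 k = trans (*-comm 2 k) (sym (+-identityʳ (k * 2)))

diff-vanishesAbove-2k : ∀ k → VanishesAbove (2 * k) (diff k 0)
diff-vanishesAbove-2k k = subst (λ d → VanishesAbove d (diff k 0)) (sym (2*k≡k*2+0 k)) (diff-vanishesAbove k 0)

F≡eval-returnPolynomial : ∀ k n → fromℕ (F (n + 2 * k) (+ n) (+ 0)) ≡ eval (returnPolynomial k) (fromℕ n)
F≡eval-returnPolynomial k n = trans
  (cong fromℕ (F-value k 0 n (n + 2 * k) (trans (+-comm n (2 * k)) (cong (_+ n) (*-comm 2 k)))))
  (value-newton (diff-vanishesAbove-2k k) n)

-- The top coefficient is `diff k 0 d` over d!, and `diff k 0 d` is the Catalan number d!/(k!(k+1)!)
-- for d = 2k; so d! cancels.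
leading-returnPolynomial : ∀ k → fromℕ (k ! * (k + 1) !) ℚ.* coeff (returnPolynomial k) (2 * k) ≡ 1ℚ
leading-returnPolynomial k = begin
  b ℚ.* c
    ≡⟨ ℚ.*-identityʳ (b ℚ.* c) ⟨
  b ℚ.* c ℚ.* 1ℚ
    ≡⟨ cong (b ℚ.* c ℚ.*_) (fromℕ-*-1/ (d !) {{d !≢0}}) ⟨
  b ℚ.* c ℚ.* (f ℚ.* f⁻¹)
    ≡⟨ solve 4 (λ b c f g → b :* c :* (f :* g) := (c :* f) :* b :* g) refl b c f f⁻¹ ⟩
  (c ℚ.* f) ℚ.* b ℚ.* f⁻¹
    ≡⟨ cong (λ t → t ℚ.* b ℚ.* f⁻¹) (coeff-newton-top d (diff k 0)) ⟩
  fromℕ (diff k 0 d) ℚ.* b ℚ.* f⁻¹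
    ≡⟨ cong (ℚ._* f⁻¹) (fromℕ-* (diff k 0 d) (k ! * (k + 1) !)) ⟨
  fromℕ (diff k 0 d * (k ! * (k + 1) !)) ℚ.* f⁻¹
    ≡⟨ cong (λ m → fromℕ m ℚ.* f⁻¹) ballot ⟩
  f ℚ.* f⁻¹
    ≡⟨ fromℕ-*-1/ (d !) {{d !≢0}} ⟩
  1ℚ ∎
  where
  d = 2 * k
  b = fromℕ (k ! * (k + 1) !)
  c = coeff (returnPolynomial k) d
  f = fromℕ (d !)
  f⁻¹ = (+ 1 / (d !)) {{d !≢0}}
  ballot : diff k 0 d * (k ! * (k + 1) !) ≡ d !
  ballot = begin
    diff k 0 d * (k ! * (k + 1) !)
      ≡⟨ cong₂ (λ e m → diff k 0 e * (k ! * m !)) (2*k≡k*2+0 k) (+-suc k 0) ⟩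
    diff k 0 (k * 2 + 0) * (k ! * suc (k + 0) !)
      ≡⟨ diff-top k 0 ⟩
    (k * 2 + 0) ! * 1
      ≡⟨ trans (*-comm ((k * 2 + 0) !) 1) (+-identityʳ ((k * 2 + 0) !)) ⟩
    (k * 2 + 0) !
      ≡⟨ cong _! (2*k≡k*2+0 k) ⟨
    d ! ∎

degree-returnPolynomial : ∀ k → HasDegree (returnPolynomial k) (2 * k)
degree-returnPolynomial k = nonzero , λ _ → coeff-newton-above (2 * k) (diff k 0)
  where
  1≢0 : 1ℚ ≢ 0ℚ
  1≢0 ()
  nonzero : coeff (returnPolynomial k) (2 * k) ≢ 0ℚ
  nonzero c≡0 = 1≢0 (trans (sym (leading-returnPolynomial k))
    (trans (cong (fromℕ (k ! * (k + 1) !) ℚ.*_) c≡0) (ℚ.*-zeroʳ (fromℕ (k ! * (k + 1) !)))))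

X+1∣returnPolynomial : ∀ k → 1 ≤ k → X+1 ∣ returnPolynomial k
X+1∣returnPolynomial (suc k) _ = root⇒X+1∣ (returnPolynomial (suc k))
  (newton-diff-at-−1 k 0 (≤-reflexive (sym (2*k≡k*2+0 (suc k)))))

-- Explicit formulas for small k

horner : List ℕ → ℕ → ℕ
horner []       n = 0
horner (c ∷ cs) n = n * horner cs n + c

-- Moves evaluation into the naturals, where the factored forms become semiring identities.
eval-map-fromℕ : ∀ cs n → eval (map fromℕ cs) (fromℕ n) ≡ fromℕ (horner cs n)
eval-map-fromℕ []       n = refl
eval-map-fromℕ (c ∷ cs) n = begin
  fromℕ c ℚ.+ fromℕ n ℚ.* eval (map fromℕ cs) (fromℕ n)
    ≡⟨ cong (λ e → fromℕ c ℚ.+ fromℕ n ℚ.* e) (eval-map-fromℕ cs n) ⟩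
  fromℕ c ℚ.+ fromℕ n ℚ.* fromℕ (horner cs n)
    ≡⟨ cong (fromℕ c ℚ.+_) (fromℕ-* n (horner cs n)) ⟨
  fromℕ c ℚ.+ fromℕ (n * horner cs n)
    ≡⟨ ℚ.+-comm (fromℕ c) (fromℕ (n * horner cs n)) ⟩
  fromℕ (n * horner cs n) ℚ.+ fromℕ c
    ≡⟨ fromℕ-+ (n * horner cs n) c ⟨
  fromℕ (n * horner cs n + c) ∎

closed-form : ∀ k r cs → returnPolynomial k ≡ map (r ℚ.*_) (map fromℕ cs) →
  ∀ n → fromℕ (F (n + 2 * k) (+ n) (+ 0)) ≡ r ℚ.* fromℕ (horner cs n)
closed-form k r cs s≡ n = begin
  fromℕ (F (n + 2 * k) (+ n) (+ 0))             ≡⟨ F≡eval-returnPolynomial k n ⟩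
  eval (returnPolynomial k) (fromℕ n)           ≡⟨ cong (λ q → eval q (fromℕ n)) s≡ ⟩
  eval (map (r ℚ.*_) (map fromℕ cs)) (fromℕ n)  ≡⟨ eval-scale r (map fromℕ cs) (fromℕ n) ⟩
  r ℚ.* eval (map fromℕ cs) (fromℕ n)           ≡⟨ cong (r ℚ.*_) (eval-map-fromℕ cs n) ⟩
  r ℚ.* fromℕ (horner cs n) ∎

-- The list is the expanded product of n + 1 with the other factor, constant term first. Both sides
-- are closed, so `refl` runs the recursion for `diff`; likewise for the next two.
returnPolynomial-1 : returnPolynomial 1 ≡ map ((+ 1 / 2) ℚ.*_) (map fromℕ (4 ∷ 5 ∷ 1 ∷ []))
returnPolynomial-1 = refl

returnPolynomial-2 : returnPolynomial 2 ≡
  map ((+ 1 / 12) ℚ.*_) (map fromℕ (132 ∷ 206 ∷ 89 ∷ 16 ∷ 1 ∷ []))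
returnPolynomial-2 = refl

returnPolynomial-3 : returnPolynomial 3 ≡
  map ((+ 1 / 144) ℚ.*_) (map fromℕ (12240 ∷ 20844 ∷ 11224 ∷ 3027 ∷ 439 ∷ 33 ∷ 1 ∷ []))
returnPolynomial-3 = refl

value-constant : ∀ n → value (diff 0 0) n ≡ 1
value-constant zero    = refl
value-constant (suc n) = trans (value-+ (diff 0 0) (diff 0 0 ∘ suc) n)
                               (cong₂ _+_ (value-constant n) (value-0 n))

-- The coefficients are variables here: with the actual values the ring solver
-- would compute with unary literals.
horner-linear : ∀ a n → horner (a ∷ a + 1 ∷ 1 ∷ []) n ≡ (n + 1) * (n + a)
horner-linear = expanded
  where
  expanded : ∀ a n → n * (n * (n * 0 + 1) + (a + 1)) + a ≡ (n + 1) * (n + a)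
  expanded = solve-∀

-- Multiplying by n + 1 adds neighbouring coefficients, whence `a + b`, `b + c` and `c + 1`.
horner-cubic : ∀ a b c n → horner (a ∷ a + b ∷ b + c ∷ c + 1 ∷ 1 ∷ []) n ≡
  (n + 1) * (n ^ 3 + c * n ^ 2 + b * n + a)
horner-cubic = expanded
  where
  -- The goal with `horner` and `_^_` unfolded into sums and products for the ring solver.
  expanded : ∀ a b c n →
    n * (n * (n * (n * (n * 0 + 1) + (c + 1)) + (b + c)) + (a + b)) + a ≡
    (n + 1) * (n * (n * (n * 1)) + c * (n * (n * 1)) + b * n + a)
  expanded = solve-∀

horner-quintic : ∀ a b c d e n →
  horner (a ∷ a + b ∷ b + c ∷ c + d ∷ d + e ∷ e + 1 ∷ 1 ∷ []) n ≡
  (n + 1) * (n ^ 5 + e * n ^ 4 + d * n ^ 3 + c * n ^ 2 + b * n + a)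
horner-quintic = expanded
  where
  expanded : ∀ a b c d e n →
    n * (n * (n * (n * (n * (n * (n * 0 + 1) + (e + 1)) + (d + e)) + (c + d)) + (b + c)) + (a + b)) + a ≡
    (n + 1) * (n * (n * (n * (n * (n * 1)))) + e * (n * (n * (n * (n * 1)))) +
      d * (n * (n * (n * 1))) + c * (n * (n * 1)) + b * n + a)
  expanded = solve-∀

corollary6 : (∀ (n : ℕ) →
    F n (+ n) (+ 0) ≡ 1
    × fromℕ (F (n + 2) (+ n) (+ 0))
    ≡ (+ 1 / 2) ℚ.* fromℕ ((n + 1) * (n + 4))
    × fromℕ (F (n + 4) (+ n) (+ 0))
    ≡ (+ 1 / 12) ℚ.* fromℕ ((n + 1) * (n ^ 3 + 15 * n ^ 2 + 74 * n + 132))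
    × fromℕ (F (n + 6) (+ n) (+ 0))
    ≡ (+ 1 / 144) ℚ.* fromℕ ((n + 1) * (n ^ 5 + 32 * n ^ 4 + 407 * n ^ 3 + 2620 * n ^ 2 + 8604 * n + 12240)))
    × (∀ (k : ℕ) → ∃[ s ]
    ( HasDegree s (2 * k)
    × coeff s (2 * k) ≡ (+ 1 / (k ! * (k + 1) !)) {{k !* (k + 1) !≢0}}
    × (∀ (n : ℕ) → fromℕ (F (n + 2 * k) (+ n) (+ 0)) ≡ eval s (fromℕ n))
    × (1 ≤ k → X+1 ∣ s)))
corollary6 =
    (λ n → trans (F-value 0 0 n n refl) (value-constant n)
         -- `2 * k` computes to 2, 4, 6, and sums such as `132 + 74` compute to the listed
         -- coefficients, so the lemmas fit without rewriting.
         , trans (closed-form 1 (+ 1 / 2) (4 ∷ 5 ∷ 1 ∷ []) returnPolynomial-1 n)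
                 (cong (λ m → (+ 1 / 2) ℚ.* fromℕ m) (horner-linear 4 n))
         , trans (closed-form 2 (+ 1 / 12) (132 ∷ 206 ∷ 89 ∷ 16 ∷ 1 ∷ []) returnPolynomial-2 n)
                 (cong (λ m → (+ 1 / 12) ℚ.* fromℕ m) (horner-cubic 132 74 15 n))
         , trans (closed-form 3 (+ 1 / 144) (12240 ∷ 20844 ∷ 11224 ∷ 3027 ∷ 439 ∷ 33 ∷ 1 ∷ [])
                   returnPolynomial-3 n)
                 (cong (λ m → (+ 1 / 144) ℚ.* fromℕ m) (horner-quintic 12240 8604 2620 407 32 n)))
  , λ k → returnPolynomial k , degree-returnPolynomial k
        , 1/-unique (k ! * (k + 1) !) {{k !* (k + 1) !≢0}} (leading-returnPolynomial k)
        , F≡eval-returnPolynomial k , X+1∣returnPolynomial k
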